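{- Let $n$ and $q$ be natural numbers. There exists a natural number $m_0=m_0(n,q)$ such that for all natural numbers $p$ and $m$ with $p\leqslant 2q-1$ and $m\geqslant m_0$, Breaker has a winning strategy for the $(p,q)$-crossing game on $\Lambda_{m\times n}$.
   Context: $\Lambda_{m\times n}$ is the grid graph with vertex set $\{(x,y): x\in[m], y\in[n]\}$, two vertices adjacent iff at Euclidean distance $1$. A left-right crossing path is a path in the board joining some vertex $(1,y)$ to some vertex $(m,y')$. The $(p,q)$-crossing game on $\Lambda_{m\times n}$: Maker and Breaker alternate turns, Maker first. On each turn Maker claims $p$ as-yet unclaimed edges and Breaker claims $q$ as-yet unclaimed edges. Maker wins if she claims all edges of a left-right crossing path; Breaker wins if the board reaches a state where Maker can never claim such a path. -}

module Defs where

open import Data.Nat using (ℕ; zero; suc; _<_)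
open import Data.Fin using (Fin; toℕ)
open import Data.Product using (Σ; _×_; _,_; proj₁; proj₂)
open import Data.Sum using (_⊎_)
open import Data.List using (List; []; _∷_; _++_; length)
open import Data.List.Membership.Propositional using (_∈_)
open import Data.List.Relation.Unary.All using (All)
open import Data.List.Relation.Unary.Linked using (Linked)
open import Data.List.Relation.Unary.Unique.Propositional using (Unique)
open import Relation.Binary.PropositionalEquality using (_≡_)
open import Relation.Nullary using (¬_)
open import Data.Nat using (_∸_)

-- Vertices of Λ_{m×n}: (x , y) with x ∈ Fin m, y ∈ Fin n
-- (0-indexed: paper's x ∈ [m] corresponds to toℕ x + 1).
Vertex : ℕ → ℕ → Set
Vertex m n = Fin m × Fin n

-- Canonical orientation of an edge: v is the right neighbour or the upper
-- neighbour of u.  Every edge {u,v} of Λ_{m×n} (Euclidean distance 1)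
-- corresponds to exactly one ordered pair (u , v) with Step u v.
Step : ∀ {m n} → Vertex m n → Vertex m n → Set
Step (x , y) (x' , y') =
  (toℕ x' ≡ suc (toℕ x) × y ≡ y') ⊎ (x ≡ x' × toℕ y' ≡ suc (toℕ y))

Adj : ∀ {m n} → Vertex m n → Vertex m n → Set
Adj u v = Step u v ⊎ Step v u

-- A set of claimed edges, stored as a list of canonically oriented pairs.
EdgeSet : ℕ → ℕ → Set
EdgeSet m n = List (Vertex m n × Vertex m n)

Claimed : ∀ {m n} → EdgeSet m n → Vertex m n → Vertex m n → Set
Claimed S u v = ((u , v) ∈ S) ⊎ ((v , u) ∈ S)

lastV : ∀ {A : Set} → A → List A → A
lastV u []       = u
lastV u (v ∷ vs) = lastV v vs

record CrossingPath (m n : ℕ) : Set where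
  field
    start  : Vertex m n
    rest   : List (Vertex m n)
    adj    : Linked Adj (start ∷ rest)
    simple : Unique (start ∷ rest)
    left   : toℕ (proj₁ start) ≡ 0
    right  : toℕ (proj₁ (lastV start rest)) ≡ m ∸ 1

open CrossingPath public

MakerWon : ∀ {m n} → EdgeSet m n → Set
MakerWon {m} {n} M =
  Σ (CrossingPath m n) λ P → Linked (Claimed M) (start P ∷ rest P)

BreakerWon : ∀ {m n} → EdgeSet m n → Set
BreakerWon {m} {n} B =
  (P : CrossingPath m n) → ¬ Linked (λ u v → ¬ Claimed B u v) (start P ∷ rest P)

ValidMove : ∀ {m n} → ℕ → EdgeSet m n → EdgeSet m n → EdgeSet m n → Set
ValidMove {m} {n} k M B mv =
  Unique mv
  × All (λ e → Step (proj₁ e) (proj₂ e)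
               × ¬ Claimed M (proj₁ e) (proj₂ e)
               × ¬ Claimed B (proj₁ e) (proj₂ e)) mv
  × (length mv ≡ k
     ⊎ (length mv < k
        × ((u v : Vertex m n) → Step u v → ¬ Claimed M u v → ¬ Claimed B u v
           → (u , v) ∈ mv)))

-- Breaker has a winning strategy in the (p,q)-crossing game on Λ_{m×n}
-- from the position (M , B).  BreakerWinsM: Maker to move;
-- BreakerWinsB: Breaker to move.  Inductive, so Breaker must actually
-- reach a winning position (the game is finite anyway).
mutual
  data BreakerWinsM (m n p q : ℕ) (M B : EdgeSet m n) : Set where
    wonM  : BreakerWon B → BreakerWinsM m n p q M B
    moveM : ((mv : EdgeSet m n) → ValidMove p M B mv
               → BreakerWinsB m n p q (mv ++ M) B)
          → BreakerWinsM m n p q M B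

  data BreakerWinsB (m n p q : ℕ) (M B : EdgeSet m n) : Set where
    wonB  : BreakerWon B → BreakerWinsB m n p q M B
    moveB : ¬ MakerWon M
          → Σ (EdgeSet m n) (λ mv → ValidMove q M B mv
               × BreakerWinsM m n p q M (mv ++ B))
          → BreakerWinsB m n p q M B

BreakerWinsGame : ℕ → ℕ → ℕ → ℕ → Set
BreakerWinsGame m n p q = BreakerWinsM m n p q [] []

{-# OPTIONS --safe #-}

-- Cut the board into many disjoint blocks of n columns.  In a block, Breaker wants
-- a top-bottom path in the dual graph.  That is a Shannon switching game: two
-- disjoint edge sets, each spanning together with Breaker's edges, let Breaker
-- answer every single edge of Maker by reconnecting, so Breaker moving first wins a
-- block in which Maker never plays more edges than Breaker.  Since p < 2q, whenever
-- Breaker plays one edge in each of q blocks, Maker cannot afford two replies to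
-- every one of them.  Iterating over a huge number of blocks, stage by stage, some
-- block receives at most one reply to each of Breaker's edges until it is won.

module Submission where

open import Defs
open import Data.Nat using (ℕ; _≤_; _+_; _*_)
open import Data.Product using (Σ)

open import Data.Nat using (zero; suc; _∸_; _<_; _<ᵇ_; z≤n; s≤s)
import Data.Nat.Properties as ℕ
open import Data.Nat.Tactic.RingSolver using (solve-∀)
open import Algebra.Properties.CommutativeSemigroup ℕ.+-commutativeSemigroup using (x∙yz≈y∙xz)
open import Algebra.Properties.Monoid.Sum ℕ.+-0-monoid using (sum)
open import Data.Bool using (Bool; true; false; _∧_; _xor_)
import Data.Bool.Properties as Bool
open import Data.Bool.Solver using (module xor-∧-Solver)
open import Data.Fin using (Fin; zero; suc; toℕ; fromℕ; inject₁; inject≤; combine)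
open import Data.Fin.Induction using (<-weakInduction; >-weakInduction)
import Data.Fin.Properties as Fin
open import Data.Fin.Relation.Unary.Top using (view; ‵fromℕ; ‵inject₁)
open import Data.List using (List; []; _∷_; _++_; length; filter; map; allFin; cartesianProduct)
import Data.List.Membership.DecPropositional as DecMembership
open import Data.List.Membership.Propositional using (_∈_; _∉_)
open import Data.List.Membership.Propositional.Properties
open import Data.List.Properties using (filter-notAll)
open import Data.List.Relation.Binary.Disjoint.Propositional using (Disjoint)
open import Data.List.Relation.Unary.All as All using (All; []; _∷_)
open import Data.List.Relation.Unary.AllPairs using ([]; _∷_)
open import Data.List.Relation.Unary.Any as Any using (here; there)
open import Data.List.Relation.Unary.Linked as Linked using (Linked; _∷_)
open import Data.List.Relation.Unary.Unique.Propositional using (Unique)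
open import Data.Product using (∃-syntax; _×_; _,_; proj₁; proj₂)
import Data.Product.Properties as Product
open import Data.Sum as Sum using (_⊎_; inj₁; inj₂; [_,_]′)
import Data.Sum.Properties as Sum
open import Data.Unit using (⊤; tt)
open import Data.Vec.Functional using (Vector; updateAt)
open import Data.Vec.Functional.Properties using (updateAt-updates; updateAt-minimal)
open import Function using (_∘_; id; const)
open import Level using (0ℓ)
open import Relation.Binary using (Rel; DecidableEquality)
open import Relation.Binary.Construct.Closure.Equivalence as Eq using (EqClosure)
open import Relation.Binary.Construct.Closure.ReflexiveTransitive using (ε; _◅_; _◅◅_)
open import Relation.Binary.Construct.Closure.Symmetric using (fwd; bwd)
open import Relation.Binary.PropositionalEquality
open import Relation.Nullary using (¬_; ¬?; Dec; yes; no; contradiction)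
open import Relation.Unary using (Pred; Decidable; _∪_; _⊆_; ｛_｝)

-- The Shannon switching game on an abstract graph.

module Switching {V E : Set} (_≟_ : DecidableEquality E)
                 (src tgt : E → V) (_∼_ : Rel V 0ℓ) where

  open DecMembership _≟_ using (_∈?_)

  -- Pairs related by `_∼_` act as permanent links that neither player can take; they will merge the
  -- faces outside the board.
  Link : Pred E 0ℓ → Rel V 0ℓ
  Link X u v = (∃[ e ] X e × src e ≡ u × tgt e ≡ v) ⊎ u ∼ v

  Joined : Pred E 0ℓ → Rel V 0ℓ
  Joined X = EqClosure (Link X)

  Spanning : Pred E 0ℓ → Set
  Spanning X = ∀ u v → Joined X u v

  joined-mono : ∀ {X Y} → X ⊆ Y → ∀ {u v} → Joined X u v → Joined Y u v
  joined-mono X⊆Y = Eq.map (Sum.map₁ λ (e , Xe , ends) → e , X⊆Y Xe , ends)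

  joined-sym : ∀ {X u v} → Joined X u v → Joined X v u
  joined-sym {X} = Eq.symmetric (Link X)

  edge : ∀ {X : Pred E 0ℓ} e → X e → Joined X (src e) (tgt e)
  edge e Xe = Eq.return (inj₁ (e , Xe , refl , refl))

  slide : ∀ {X u v} → u ∼ v → Joined X u v
  slide = Eq.return ∘ inj₂

  -- Lehman's invariant for the Shannon switching game, with M and B the edges
  -- already claimed.  When s and t coincide, B ∪ T₁ and B ∪ T₂ are both
  -- spanning; otherwise B ∪ T₁ may have come apart into the components of s and t.
  record Position (k : ℕ) (s t : V) (M B : Pred E 0ℓ) : Set where
    field
      T₁ T₂     : List E
      disjoint  : Disjoint T₁ T₂
      free₁     : ∀ {e} → e ∈ T₁ → ¬ M e × ¬ B e
      free₂     : ∀ {e} → e ∈ T₂ → ¬ M e × ¬ B e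
      near      : ∀ v → Joined (B ∪ (_∈ T₁)) v s ⊎ Joined (B ∪ (_∈ T₁)) v t
      spanning₂ : Spanning (B ∪ (_∈ T₂))
      size      : length T₁ + length T₂ ≤ k

  open Position

  -- `k` bounds the free edges of the two sets, hence the moves Breaker may still need. `Balanced`
  -- withstands one edge of Maker and becomes `Pending`; `Ready` holds an edge `f` whose claiming
  -- restores balance.
  Pending Balanced Ready : ℕ → Pred E 0ℓ → Pred E 0ℓ → Set
  Pending k M B  = ∃[ s ] ∃[ t ] Position k s t M B
  Balanced k M B = ∃[ s ] Position k s s M B
  Ready k M B    = ∃[ f ] ¬ M f × ¬ B f × Balanced k M (B ∪ ｛ f ｝)

  position-resp : ∀ {k s t M B M′ B′} → M′ ⊆ M → B ⊆ B′ → B′ ⊆ B →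
                  Position k s t M B → Position k s t M′ B′
  position-resp M′⊆M B⊆B′ B′⊆B P = record
    { T₁        = T₁ P
    ; T₂        = T₂ P
    ; disjoint  = disjoint P
    ; free₁     = λ e∈ → proj₁ (free₁ P e∈) ∘ M′⊆M , proj₂ (free₁ P e∈) ∘ B′⊆B
    ; free₂     = λ e∈ → proj₁ (free₂ P e∈) ∘ M′⊆M , proj₂ (free₂ P e∈) ∘ B′⊆B
    ; near      = Sum.map (joined-mono (Sum.map₁ B⊆B′)) (joined-mono (Sum.map₁ B⊆B′)) ∘ near P
    ; spanning₂ = λ u v → joined-mono (Sum.map₁ B⊆B′) (spanning₂ P u v)
    ; size      = size P
    }

  ready-resp : ∀ {k M B M′ B′} → M′ ⊆ M → B ⊆ B′ → B′ ⊆ B →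
               Ready k M B → Ready k M′ B′
  ready-resp M′⊆M B⊆B′ B′⊆B (f , f∉M , f∉B , s , P) =
    f , f∉M ∘ M′⊆M , f∉B ∘ B′⊆B , s ,
    position-resp M′⊆M (Sum.map₁ B⊆B′) (Sum.map₁ B′⊆B) P

  spanning₁ : ∀ {k s M B} (P : Position k s s M B) → Spanning (B ∪ (_∈ T₁ P))
  spanning₁ P u v = toCentre u ◅◅ joined-sym (toCentre v)
    where
    toCentre : ∀ w → Joined _ w _
    toCentre w = [ id , id ]′ (near P w)

  swap : ∀ {k s M B} → Position k s s M B → Position k s s M B
  swap {k} {s} P = record
    { T₁        = T₂ P
    ; T₂        = T₁ P
    ; disjoint  = λ (e∈₂ , e∈₁) → disjoint P (e∈₁ , e∈₂)
    ; free₁     = free₂ P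
    ; free₂     = free₁ P
    ; near      = λ v → inj₁ (spanning₂ P v s)
    ; spanning₂ = spanning₁ P
    ; size      = subst (_≤ k) (ℕ.+-comm (length (T₁ P)) _) (size P)
    }

  infixl 6 _∖_
  _∖_ : List E → E → List E
  T ∖ e = filter (λ x → ¬? (x ≟ e)) T

  ∖-length : ∀ {e T} → e ∈ T → length (T ∖ e) < length T
  ∖-length {e} {T} e∈T =
    filter-notAll (λ x → ¬? (x ≟ e)) T (Any.map (λ e≡x x≢e → x≢e (sym e≡x)) e∈T)

  ∈-∖⁺ : ∀ {e x T} → x ∈ T → x ≢ e → x ∈ T ∖ e
  ∈-∖⁺ {e} = ∈-filter⁺ (λ x → ¬? (x ≟ e))

  ∈-∖⁻ : ∀ {e x T} → x ∈ T ∖ e → x ∈ T × x ≢ e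
  ∈-∖⁻ {e} = ∈-filter⁻ (λ x → ¬? (x ≟ e))

  -- The walk is cut at its first use of `e` as a link from `T`: the part before survives the
  -- removal and stops at an end of `e`.
  joined-remove : ∀ {X T} e {u} → Joined (X ∪ (_∈ T)) u (src e) →
                  Joined (X ∪ (_∈ T ∖ e)) u (src e) ⊎ Joined (X ∪ (_∈ T ∖ e)) u (tgt e)
  joined-remove e ε = inj₁ ε
  joined-remove {X} {T} e (l ◅ ls) with joined-remove {X} {T} e ls
  ... | rest with l
  ...   | fwd (inj₂ u∼v) = Sum.map (fwd (inj₂ u∼v) ◅_) (fwd (inj₂ u∼v) ◅_) rest
  ...   | bwd (inj₂ u∼v) = Sum.map (bwd (inj₂ u∼v) ◅_) (bwd (inj₂ u∼v) ◅_) rest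
  ...   | fwd (inj₁ (x , inj₁ Xx , ends)) =
    let l′ = fwd (inj₁ (x , inj₁ Xx , ends)) in Sum.map (l′ ◅_) (l′ ◅_) rest
  ...   | bwd (inj₁ (x , inj₁ Xx , ends)) =
    let l′ = bwd (inj₁ (x , inj₁ Xx , ends)) in Sum.map (l′ ◅_) (l′ ◅_) rest
  ...   | fwd (inj₁ (x , inj₂ x∈T , ends)) with x ≟ e
  ...     | no x≢e = let l′ = fwd (inj₁ (x , inj₂ (∈-∖⁺ x∈T x≢e) , ends)) in
                     Sum.map (l′ ◅_) (l′ ◅_) rest
  joined-remove e _ | _ | fwd (inj₁ (_ , _ , refl , _)) | yes refl = inj₁ ε
  joined-remove {X} {T} e _ | rest | bwd (inj₁ (x , inj₂ x∈T , ends)) with x ≟ e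
  ... | no x≢e = let l′ = bwd (inj₁ (x , inj₂ (∈-∖⁺ x∈T x≢e) , ends)) in
                 Sum.map (l′ ◅_) (l′ ◅_) rest
  joined-remove e _ | _ | bwd (inj₁ (_ , _ , _ , refl)) | yes refl = inj₂ ε

  -- Removing one edge splits a spanning set into at most two parts, one around each end of that
  -- edge; these ends become the new `s` and `t`.
  lose₁ : ∀ {k s M M′ B e} → ¬ B e → (∀ {x} → M′ x → M x ⊎ x ≡ e) →
          (P : Position k s s M B) → e ∈ T₁ P → Position k (src e) (tgt e) M′ B
  lose₁ {k} {M = M} {M′} {B} {e} e∉B M′⊆ P e∈T₁ = record
    { T₁        = T₁ P ∖ e
    ; T₂        = T₂ P
    ; disjoint  = λ (x∈₁ , x∈₂) → disjoint P (proj₁ (∈-∖⁻ x∈₁) , x∈₂)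
    ; free₁     = λ x∈ → let x∈₁ , x≢e = ∈-∖⁻ x∈ in
                    stillFree x≢e (proj₁ (free₁ P x∈₁)) , proj₂ (free₁ P x∈₁)
    ; free₂     = λ x∈ → stillFree (λ { refl → disjoint P (e∈T₁ , x∈) }) (proj₁ (free₂ P x∈)) ,
                    proj₂ (free₂ P x∈)
    ; near      = λ v → joined-remove {B} {T₁ P} e (spanning₁ P v (src e))
    ; spanning₂ = spanning₂ P
    ; size      = ℕ.≤-trans (ℕ.+-monoˡ-≤ _ (ℕ.<⇒≤ (∖-length e∈T₁))) (size P)
    }
    where
    stillFree : ∀ {x} → x ≢ e → ¬ M x → ¬ M′ x
    stillFree x≢e x∉M x∈M′ = [ x∉M , x≢e ]′ (M′⊆ x∈M′)

  lose : ∀ {k M M′ B e} → ¬ B e → (∀ {x} → M′ x → M x ⊎ x ≡ e) →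
         Balanced k M B → Pending k M′ B
  lose {e = e} e∉B M′⊆ (s , P) with e ∈? T₁ P | e ∈? T₂ P
  ... | yes e∈T₁ | _        = src e , tgt e , lose₁ e∉B M′⊆ P e∈T₁
  -- The two sets are exchanged so that the damaged one is always `T₁`.
  ... | no _     | yes e∈T₂ = src e , tgt e , lose₁ e∉B M′⊆ (swap P) e∈T₂
  ... | no e∉T₁  | no e∉T₂  = s , s , record
    { T₁ = T₁ P ; T₂ = T₂ P ; disjoint = disjoint P
    ; free₁ = λ x∈ → stillFree (λ { refl → e∉T₁ x∈ }) (free₁ P x∈)
    ; free₂ = λ x∈ → stillFree (λ { refl → e∉T₂ x∈ }) (free₂ P x∈)
    ; near = near P ; spanning₂ = spanning₂ P ; size = size P
    }
    where
    stillFree : ∀ {x} → x ≢ e → ¬ _ × ¬ _ → ¬ _ × ¬ _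
    stillFree x≢e (x∉M , x∉B) = (λ x∈M′ → [ x∉M , x≢e ]′ (M′⊆ x∈M′)) , x∉B

  -- Along a walk in B ∪ T₂ from s to t, the component of B ∪ T₁ must change,
  -- and it can only do so across an edge of T₂.
  reconnecting : ∀ {X Y T s t} → (∀ {e} → X e → Y e) →
                 (∀ v → Joined Y v s ⊎ Joined Y v t) →
                 ∀ {u} → Joined Y u s → Joined (X ∪ (_∈ T)) u t →
                 Joined Y t s ⊎ (∃[ f ] f ∈ T × Joined (Y ∪ ｛ f ｝) t s)
  reconnecting X⊆Y near us ε = inj₁ us
  reconnecting {Y = Y} {T} {s} {t} X⊆Y near {u} us (l ◅ ls) with l
  ... | fwd (inj₂ u∼v) = reconnecting X⊆Y near (bwd (inj₂ u∼v) ◅ us) ls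
  ... | bwd (inj₂ u∼v) = reconnecting X⊆Y near (fwd (inj₂ u∼v) ◅ us) ls
  ... | fwd (inj₁ (e , inj₁ Xe , ends)) = reconnecting X⊆Y near (bwd (inj₁ (e , X⊆Y Xe , ends)) ◅ us) ls
  ... | bwd (inj₁ (e , inj₁ Xe , ends)) = reconnecting X⊆Y near (fwd (inj₁ (e , X⊆Y Xe , ends)) ◅ us) ls
  ... | fwd (inj₁ (e , inj₂ e∈T , refl , refl)) with near (tgt e)
  ...   | inj₁ vs = reconnecting X⊆Y near vs ls
  ...   | inj₂ vt = inj₂ (e , e∈T , joined-mono inj₁ (joined-sym vt) ◅◅
                      joined-sym (edge e (inj₂ refl)) ◅◅ joined-mono inj₁ us)
  reconnecting X⊆Y near us (_ ◅ ls) | bwd (inj₁ (e , inj₂ e∈T , refl , refl)) with near (src e)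
  ...   | inj₁ vs = reconnecting X⊆Y near vs ls
  ...   | inj₂ vt = inj₂ (e , e∈T , joined-mono inj₁ (joined-sym vt) ◅◅
                      edge e (inj₂ refl) ◅◅ joined-mono inj₁ us)

  -- Moving `f` from `T₂` to Breaker keeps `B ∪ T₂` spanning, merges the parts of `B ∪ T₁`, and
  -- lowers the size.
  claim : ∀ {k s t M B f} (P : Position (suc k) s t M B) → f ∈ T₂ P →
          Joined ((B ∪ (_∈ T₁ P)) ∪ ｛ f ｝) t s → Ready k M B
  claim {k} {s} {t} {M} {B} {f} P f∈T₂ ts =
    f , proj₁ (free₂ P f∈T₂) , proj₂ (free₂ P f∈T₂) , s , record
    { T₁        = T₁ P
    ; T₂        = T₂ P ∖ f
    ; disjoint  = λ (x∈₁ , x∈₂) → disjoint P (x∈₁ , proj₁ (∈-∖⁻ x∈₂))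
    ; free₁     = λ x∈ → proj₁ (free₁ P x∈) ,
                    [ proj₂ (free₁ P x∈) , (λ { refl → disjoint P (x∈ , f∈T₂) }) ]′
    ; free₂     = λ x∈ → let x∈₂ , x≢f = ∈-∖⁻ x∈ in
                    proj₁ (free₂ P x∈₂) , [ proj₂ (free₂ P x∈₂) , x≢f ∘ sym ]′
    ; near      = λ v → inj₁ ([ joined-mono (widen ∘ inj₁)
                              , (λ vt → joined-mono (widen ∘ inj₁) vt ◅◅ joined-mono widen ts)
                              ]′ (near P v))
    ; spanning₂ = λ u v → joined-mono keep (spanning₂ P u v)
    ; size      = ℕ.≤-pred (ℕ.≤-trans (subst (_≤ length (T₁ P) + length (T₂ P)) (ℕ.+-suc _ _)
                    (ℕ.+-monoʳ-≤ (length (T₁ P)) (∖-length f∈T₂))) (size P))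
    }
    where
    widen : (B ∪ (_∈ T₁ P)) ∪ ｛ f ｝ ⊆ (B ∪ ｛ f ｝) ∪ (_∈ T₁ P)
    widen (inj₁ (inj₁ Bx)) = inj₁ (inj₁ Bx)
    widen (inj₁ (inj₂ x∈)) = inj₂ x∈
    widen (inj₂ f≡x)       = inj₁ (inj₂ f≡x)
    keep : B ∪ (_∈ T₂ P) ⊆ (B ∪ ｛ f ｝) ∪ (_∈ T₂ P ∖ f)
    keep (inj₁ Bx) = inj₁ (inj₁ Bx)
    keep {x} (inj₂ x∈) with x ≟ f
    ... | yes refl = inj₁ (inj₂ refl)
    ... | no x≢f   = inj₂ (∈-∖⁺ x∈ x≢f)

  exhausted : ∀ {k s t M B} (P : Position k s t M B) → T₂ P ≡ [] → Spanning B
  exhausted P T₂≡[] u v with spanning₂ P u v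
  ... | uv rewrite T₂≡[] = joined-mono [ id , (λ ()) ]′ uv

  advance : ∀ {k M B} → Pending (suc k) M B → Spanning B ⊎ Ready k M B
  advance {B = B} (s , t , P) with T₂ P in T₂≡
  ... | []    = inj₁ (exhausted P T₂≡)
  ... | g ∷ _ with reconnecting inj₁ (near P) ε (spanning₂ P s t)
  -- Here `s` and `t` are still joined, so any edge of `T₂` will do; the size must drop all the
  -- same.
  ...   | inj₁ ts              = inj₂ (claim P (subst (g ∈_) (sym T₂≡) (here refl)) (joined-mono inj₁ ts))
  ...   | inj₂ (f , f∈T₂ , ts) = inj₂ (claim P f∈T₂ ts)

  finish : ∀ {M B} → Pending 0 M B → Spanning B
  finish (_ , _ , P) = exhausted P (empty (T₂ P) (ℕ.m+n≤o⇒n≤o (length (T₁ P)) (size P)))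
    where
    empty : ∀ T → length T ≤ 0 → T ≡ []
    empty [] _ = refl

-- The dual graph of one block and its opening position.

module Block (k : ℕ) where

  n : ℕ
  n = suc k

  -- The dual graph of n consecutive columns of horizontal edges.  A node (c , r)
  -- is the face in column c between rows r - 1 and r; the levels r = 0 and r = n
  -- lie outside the board.  A dual edge inj₁ (c , y) crosses the horizontal edge
  -- of row y in column c, and inj₂ (c , y) crosses the vertical edge between rows
  -- y and y + 1 that separates columns c and c + 1.
  Node DualEdge : Set
  Node     = Fin n × Fin (suc n)
  DualEdge = (Fin n × Fin n) ⊎ (Fin k × Fin k)

  _≟_ : DecidableEquality DualEdge
  _≟_ = Sum.≡-dec (Product.≡-dec Fin._≟_ Fin._≟_) (Product.≡-dec Fin._≟_ Fin._≟_)

  src tgt : DualEdge → Node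
  src (inj₁ (c , y)) = c , inject₁ y
  src (inj₂ (c , y)) = inject₁ c , suc (inject₁ y)
  tgt (inj₁ (c , y)) = c , suc y
  tgt (inj₂ (c , y)) = suc c , suc (inject₁ y)

  data _∼_ : Rel Node 0ℓ where
    bottom : ∀ c d → (c , zero) ∼ (d , zero)
    top    : ∀ c d → (c , fromℕ n) ∼ (d , fromℕ n)

  open Switching _≟_ src tgt _∼_ public

  south north : Node
  south = zero , zero
  north = zero , fromℕ n

  allEdges : List DualEdge
  allEdges = map inj₁ (cartesianProduct (allFin n) (allFin n)) ++
             map inj₂ (cartesianProduct (allFin k) (allFin k))

  ∈-allEdges : ∀ e → e ∈ allEdges
  ∈-allEdges (inj₁ (c , y)) =
    ∈-++⁺ˡ (∈-map⁺ inj₁ (∈-cartesianProduct⁺ (∈-allFin c) (∈-allFin y)))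
  ∈-allEdges (inj₂ (c , y)) =
    ∈-++⁺ʳ _ (∈-map⁺ inj₂ (∈-cartesianProduct⁺ (∈-allFin c) (∈-allFin y)))

  -- The diagonal and all `inj₂` edges are left to the second set, so `inj₂` gets no constructor.
  data OffDiagonal : Pred DualEdge 0ℓ where
    off : ∀ {c y} → c ≢ y → OffDiagonal (inj₁ (c , y))

  offDiagonal? : Decidable OffDiagonal
  offDiagonal? (inj₂ _) = no λ ()
  offDiagonal? (inj₁ (c , y)) with c Fin.≟ y
  ... | yes c≡y = no λ { (off c≢y) → c≢y c≡y }
  ... | no c≢y  = yes (off c≢y)

  module _ {X : Pred DualEdge 0ℓ} where

    -- Column `c` lacks at most the edge between levels `c` and `c + 1`, so a node at or below level
    -- `c` descends to the bottom and any other climbs to the top.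
    nearOutside : (∀ {e} → OffDiagonal e → X e) → ∀ v → Joined X v south ⊎ Joined X v north
    nearOutside X⊇ (c , r) with toℕ r ℕ.≤? toℕ c
    ... | yes r≤c = inj₁ (<-weakInduction (λ r → toℕ r ≤ toℕ c → Joined X (c , r) south)
                     (λ _ → slide (bottom c zero)) down r r≤c)
      where
      down : ∀ y → (toℕ (inject₁ y) ≤ toℕ c → Joined X (c , inject₁ y) south) →
             suc (toℕ y) ≤ toℕ c → Joined X (c , suc y) south
      down y below y<c =
        joined-sym (edge (inj₁ (c , y)) (X⊇ (off λ { refl → ℕ.<-irrefl refl y<c }))) ◅◅
        below (subst (_≤ toℕ c) (sym (Fin.toℕ-inject₁ y)) (ℕ.<⇒≤ y<c))
    ... | no r≰c = inj₂ (>-weakInduction (λ r → toℕ c < toℕ r → Joined X (c , r) north)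
                     (λ _ → slide (top c zero)) up r (ℕ.≰⇒> r≰c))
      where
      up : ∀ y → (toℕ c < suc (toℕ y) → Joined X (c , suc y) north) →
           toℕ c < toℕ (inject₁ y) → Joined X (c , inject₁ y) north
      up y above c<y =
        edge (inj₁ (c , y)) (X⊇ (off λ { refl → ℕ.<-irrefl refl c<y′ })) ◅◅ above (ℕ.m<n⇒m<1+n c<y′)
        where
        c<y′ : toℕ c < toℕ y
        c<y′ = subst (toℕ c <_) (Fin.toℕ-inject₁ y) c<y

    module _ (X⊇ : ∀ {e} → ¬ OffDiagonal e → X e) where

      alongLevel : ∀ c r → Joined X (c , r) (zero , r)
      alongLevel c zero    = slide (bottom c zero)
      alongLevel c (suc r) with view r
      ... | ‵fromℕ     = slide (top c zero)
      ... | ‵inject₁ y = <-weakInduction (λ c → Joined X (c , suc (inject₁ y)) (zero , suc (inject₁ y)))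
                           ε (λ c left → joined-sym (edge (inj₂ (c , y)) (X⊇ λ ())) ◅◅ left) c

      toSouth : ∀ r → Joined X (zero , r) south
      toSouth = <-weakInduction (λ r → Joined X (zero , r) south) ε λ y below →
        -- The passage from level `y + 1` down to `y` is made in column `y`, along its diagonal
        -- edge.
        joined-sym (alongLevel y (suc y)) ◅◅
        joined-sym (edge (inj₁ (y , y)) (X⊇ λ { (off y≢y) → y≢y refl })) ◅◅
        alongLevel y (inject₁ y) ◅◅ below

      spanningOn : Spanning X
      spanningOn (c , r) (d , s) = alongLevel c r ◅◅ toSouth r ◅◅
                                   joined-sym (alongLevel d s ◅◅ toSouth s)

  K : ℕ
  K = length (filter offDiagonal? allEdges) + length (filter (¬? ∘ offDiagonal?) allEdges)

  -- Leaving out the diagonal of a block splits each of its columns into a part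
  -- joined to the bottom and a part joined to the top, while the diagonal links
  -- the n + 1 levels.
  fresh : ∀ {M B} → (∀ e → ¬ M e) → (∀ e → ¬ B e) → Pending K M B
  fresh noM noB = south , north , record
    { T₁        = filter offDiagonal? allEdges
    ; T₂        = filter (¬? ∘ offDiagonal?) allEdges
    ; disjoint  = λ (e∈₁ , e∈₂) → proj₂ (∈-filter⁻ (¬? ∘ offDiagonal?) {xs = allEdges} e∈₂)
                                    (proj₂ (∈-filter⁻ offDiagonal? {xs = allEdges} e∈₁))
    ; free₁     = λ {e} _ → noM e , noB e
    ; free₂     = λ {e} _ → noM e , noB e
    ; near      = nearOutside λ {e} o → inj₂ (∈-filter⁺ offDiagonal? (∈-allEdges e) o)
    ; spanning₂ = spanningOn λ {e} ¬o → inj₂ (∈-filter⁺ (¬? ∘ offDiagonal?) (∈-allEdges e) ¬o)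
    ; size      = ℕ.≤-refl
    }

-- Parities along paths.

module _ {A : Set} where

  parity : (A → A → Bool) → A → List A → Bool
  parity F u []       = false
  parity F u (v ∷ vs) = F u v xor parity F v vs

  -- The terms `h u xor h v` telescope along the path, so only its two ends contribute.
  parity-shift : ∀ {P : A → A → Set} {F G} (h : A → Bool) →
    (∀ u v → P u v → F u v ≡ G u v xor (h u xor h v)) →
    ∀ u vs → Linked P (u ∷ vs) → parity F u vs ≡ parity G u vs xor (h u xor h (lastV u vs))
  parity-shift h F≡ u [] _ = sym (Bool.xor-same (h u))
  parity-shift {F = F} {G} h F≡ u (v ∷ vs) (Puv ∷ Pvs)
    rewrite F≡ u v Puv | parity-shift {F = F} {G} h F≡ v vs Pvs =
    solve 5 (λ g a b p l → (g :+ (a :+ b)) :+ (p :+ (b :+ l)) := (g :+ p) :+ (a :+ l)) refl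
      (G u v) (h u) (h v) (parity G v vs) (h (lastV v vs))
    where open xor-∧-Solver

  parity-cong : ∀ {P : A → A → Set} {F G} → (∀ u v → P u v → F u v ≡ G u v) →
    ∀ u vs → Linked P (u ∷ vs) → parity F u vs ≡ parity G u vs
  parity-cong F≡G u []       _           = refl
  parity-cong F≡G u (v ∷ vs) (Puv ∷ Pvs) = cong₂ _xor_ (F≡G u v Puv) (parity-cong F≡G v vs Pvs)

  parity-false : ∀ u vs → parity (λ _ _ → false) u vs ≡ false
  parity-false u []       = refl
  parity-false u (v ∷ vs) = parity-false v vs

<ᵇ-suc : ∀ {i j} → i ≢ j → (i <ᵇ j) ≡ (i <ᵇ suc j)
<ᵇ-suc {zero}  {zero}  i≢j = contradiction refl i≢j
<ᵇ-suc {zero}  {suc j} i≢j = refl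
<ᵇ-suc {suc i} {zero}  i≢j = refl
<ᵇ-suc {suc i} {suc j} i≢j = <ᵇ-suc (i≢j ∘ cong suc)

suc-<ᵇ : ∀ {i j} → j ≢ suc i → (i <ᵇ j) ≡ (suc i <ᵇ j)
suc-<ᵇ {j = zero}  _    = refl
suc-<ᵇ {j = suc j} j≢si = sym (<ᵇ-suc (j≢si ∘ cong suc ∘ sym))

<⇒<ᵇ-true : ∀ {i j} → i < j → (i <ᵇ j) ≡ true
<⇒<ᵇ-true {zero}  (s≤s _)   = refl
<⇒<ᵇ-true {suc i} (s≤s i<j) = <⇒<ᵇ-true i<j

-- How the crossing count varies with the ray.

module _ {m n : ℕ} where

  right-of : ℕ → Vertex m n → Bool
  right-of c (x , _) = c <ᵇ toℕ x

  under : ℕ → Vertex m n → Bool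
  under r (_ , y) = toℕ y <ᵇ r

  -- For adjacent u and v: whether uv is a horizontal edge of column c below level r.
  crosses : ℕ → ℕ → Vertex m n → Vertex m n → Bool
  crosses c r u v = under r u ∧ (right-of c u xor right-of c v)

  IsHorizontal : ℕ → ℕ → Vertex m n → Vertex m n → Set
  IsHorizontal c r (x , y) (x′ , y′) = toℕ x ≡ c × toℕ x′ ≡ suc c × toℕ y ≡ r × toℕ y′ ≡ r

  IsVertical : ℕ → ℕ → Vertex m n → Vertex m n → Set
  IsVertical c r (x , y) (x′ , y′) = toℕ x ≡ c × toℕ x′ ≡ c × toℕ y ≡ r × toℕ y′ ≡ suc r

  -- Levels `r` and `r + 1` differ only in row `r`, where the one horizontal edge of column `c` is
  -- excluded; a vertical edge has both ends on the same side of the ray and counts for neither.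
  crosses-up : ∀ c r u v → Adj u v → ¬ IsHorizontal c r u v → ¬ IsHorizontal c r v u →
               crosses c r u v ≡ crosses c (suc r) u v
  crosses-up c r (x , y) (x′ , _) (inj₁ (inj₁ (x′≡ , refl))) ¬uv _ with toℕ y ℕ.≟ r
  ... | no y≢r = cong₂ _∧_ (<ᵇ-suc y≢r) refl
  ... | yes y≡r
    rewrite x′≡ | sym (<ᵇ-suc {c} {toℕ x} λ c≡x → ¬uv (sym c≡x , cong suc (sym c≡x) , y≡r , y≡r))
          | Bool.xor-same (c <ᵇ toℕ x) = trans (Bool.∧-zeroʳ _) (sym (Bool.∧-zeroʳ _))
  crosses-up c r (x , y) (x′ , _) (inj₂ (inj₁ (x≡ , refl))) _ ¬vu with toℕ y ℕ.≟ r
  ... | no y≢r = cong₂ _∧_ (<ᵇ-suc y≢r) refl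
  ... | yes y≡r
    rewrite x≡ | sym (<ᵇ-suc {c} {toℕ x′} λ c≡x → ¬vu (sym c≡x , cong suc (sym c≡x) , y≡r , y≡r))
          | Bool.xor-same (c <ᵇ toℕ x′) = trans (Bool.∧-zeroʳ _) (sym (Bool.∧-zeroʳ _))
  crosses-up c r (x , y) _ (inj₁ (inj₂ (refl , _))) _ _
    rewrite Bool.xor-same (c <ᵇ toℕ x) = trans (Bool.∧-zeroʳ _) (sym (Bool.∧-zeroʳ _))
  crosses-up c r (x , y) _ (inj₂ (inj₂ (refl , _))) _ _
    rewrite Bool.xor-same (c <ᵇ toℕ x) = trans (Bool.∧-zeroʳ _) (sym (Bool.∧-zeroʳ _))

  -- Marks the vertices between the rays of columns `c` and `c + 1`: those with first coordinate
  -- `c + 1` below level `r`.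
  cornered : ℕ → ℕ → Vertex m n → Bool
  cornered c r u = under r u ∧ (right-of c u xor right-of (suc c) u)

  -- As the ray moves one column to the right it sweeps over the cornered vertices, which accounts
  -- for the correction; this fails only at the vertical edge that its tip passes.
  crosses-across : ∀ c r u v → Adj u v → ¬ IsVertical (suc c) r u v → ¬ IsVertical (suc c) r v u →
    crosses c (suc r) u v ≡
    crosses (suc c) (suc r) u v xor (cornered c (suc r) u xor cornered c (suc r) v)
  crosses-across c r u v uv ¬uv ¬vu = go uv ¬uv ¬vu
    where
    open xor-∧-Solver
    horizontal : ∀ y a b a′ b′ →
      y ∧ (a xor b) ≡ (y ∧ (a′ xor b′)) xor ((y ∧ (a xor a′)) xor (y ∧ (b xor b′)))
    horizontal = solve 5 (λ y a b a′ b′ →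
      y :* (a :+ b) := (y :* (a′ :+ b′)) :+ ((y :* (a :+ a′)) :+ (y :* (b :+ b′)))) refl
    -- Both crossing terms vanish on a vertical edge, so the corner terms must cancel: the ends
    -- agree about the level, or the edge does not lie between the two rays.
    vertical : ∀ y y′ a b → y ≡ y′ ⊎ a ≡ b →
      y ∧ (a xor a) ≡ (y ∧ (b xor b)) xor ((y ∧ (a xor b)) xor (y′ ∧ (a xor b)))
    vertical y y′ a b (inj₁ refl) = horizontal y a a b b
    vertical y y′ a b (inj₂ refl) = solve 3 (λ y y′ a →
      y :* (a :+ a) := (y :* (a :+ a)) :+ ((y :* (a :+ a)) :+ (y′ :* (a :+ a)))) refl y y′ a
    go : ∀ {u v} → Adj u v → ¬ IsVertical (suc c) r u v → ¬ IsVertical (suc c) r v u →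
      crosses c (suc r) u v ≡
      crosses (suc c) (suc r) u v xor (cornered c (suc r) u xor cornered c (suc r) v)
    go {x , y} {x′ , _} (inj₁ (inj₁ (_ , refl))) _ _ =
      horizontal (toℕ y <ᵇ suc r) (c <ᵇ toℕ x) (c <ᵇ toℕ x′) (suc c <ᵇ toℕ x) (suc c <ᵇ toℕ x′)
    go {x , y} {x′ , _} (inj₂ (inj₁ (_ , refl))) _ _ =
      horizontal (toℕ y <ᵇ suc r) (c <ᵇ toℕ x) (c <ᵇ toℕ x′) (suc c <ᵇ toℕ x) (suc c <ᵇ toℕ x′)
    go {x , y} {_ , y′} (inj₁ (inj₂ (refl , y′≡))) ¬uv _ =
      vertical _ _ (c <ᵇ toℕ x) (suc c <ᵇ toℕ x) (separated (toℕ x ℕ.≟ suc c) (toℕ y ℕ.≟ r))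
      where
      separated : Dec (toℕ x ≡ suc c) → Dec (toℕ y ≡ r) → _
      separated (no x≢)  _         = inj₂ (suc-<ᵇ x≢)
      separated (yes _)  (no y≢)   = inj₁ (trans (sym (<ᵇ-suc y≢)) (cong (_<ᵇ suc r) (sym y′≡)))
      separated (yes x≡) (yes y≡) = contradiction (x≡ , x≡ , y≡ , trans y′≡ (cong suc y≡)) ¬uv
    go {x , y} {_ , y′} (inj₂ (inj₂ (refl , y≡))) _ ¬vu =
      vertical _ _ (c <ᵇ toℕ x) (suc c <ᵇ toℕ x) (separated (toℕ x ℕ.≟ suc c) (toℕ y′ ℕ.≟ r))
      where
      separated : Dec (toℕ x ≡ suc c) → Dec (toℕ y′ ≡ r) → _
      separated (no x≢)  _         = inj₂ (suc-<ᵇ x≢)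
      separated (yes _)  (no y′≢)  = inj₁ (trans (cong (_<ᵇ suc r) y≡) (<ᵇ-suc y′≢))
      separated (yes x≡) (yes y′≡) = contradiction (x≡ , x≡ , y′≡ , trans y≡ (cong suc y′≡)) ¬vu

-- Blocks embedded in the board, and why a dual path stops every crossing path.

module Board (k R m : ℕ) (room : R * suc k < m) where
  open Block k

  column : Fin R → Fin n → ℕ
  column i c = toℕ (combine i c)

  column-suc : ∀ i (c : Fin k) → column i (suc c) ≡ suc (column i (inject₁ c))
  column-suc i c = begin
    column i (suc c)                      ≡⟨ Fin.toℕ-combine i (suc c) ⟩
    n * toℕ i + suc (toℕ c)               ≡⟨ ℕ.+-suc _ _ ⟩
    suc (n * toℕ i + toℕ c)               ≡⟨ cong (λ j → suc (n * toℕ i + j)) (Fin.toℕ-inject₁ c) ⟨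
    suc (n * toℕ i + toℕ (inject₁ c))     ≡⟨ cong suc (Fin.toℕ-combine i (inject₁ c)) ⟨
    suc (column i (inject₁ c))            ∎
    where open ≡-Reasoning

  column<last : ∀ i c → column i c < m ∸ 1
  column<last i c = ℕ.≤-trans (Fin.toℕ<n (combine i c)) (ℕ.∸-monoˡ-≤ 1 room)

  west east : Fin R → Fin n → Fin m
  west i c = inject≤ (inject₁ (combine i c)) room
  east i c = inject≤ (suc (combine i c)) room

  toℕ-west : ∀ i c → toℕ (west i c) ≡ column i c
  toℕ-west i c = trans (Fin.toℕ-inject≤ _ room) (Fin.toℕ-inject₁ _)

  toℕ-east : ∀ i c → toℕ (east i c) ≡ suc (column i c)
  toℕ-east i c = Fin.toℕ-inject≤ (suc (combine i c)) room

  west-injective : ∀ {i j c d} → west i c ≡ west j d → i ≡ j × c ≡ d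
  west-injective {i} {j} {c} {d} eq = Fin.combine-injective i c j d
    (Fin.toℕ-injective (trans (sym (toℕ-west i c)) (trans (cong toℕ eq) (toℕ-west j d))))

  Edge : Set
  Edge = Vertex m n × Vertex m n

  -- Vertical edges are taken only from vertex columns strictly inside the block, so that
  -- neighbouring blocks, which share a boundary column of vertices, share no edge.
  primal : Fin R → DualEdge → Edge
  primal i (inj₁ (c , y)) = (west i c , y) , (east i c , y)
  primal i (inj₂ (c , y)) = (west i (suc c) , inject₁ y) , (west i (suc c) , suc y)

  inject₁≢suc : ∀ {l} (y : Fin l) → inject₁ y ≢ suc y
  inject₁≢suc (suc y) eq = inject₁≢suc y (Fin.suc-injective eq)

  primal-injective : ∀ {i j d e} → primal i d ≡ primal j e → i ≡ j × d ≡ e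
  primal-injective {d = inj₁ _} {inj₁ _} eq
    with refl , refl ← west-injective (cong (proj₁ ∘ proj₁) eq)
    with refl ← cong (proj₂ ∘ proj₁) eq = refl , refl
  primal-injective {d = inj₁ _} {inj₂ (_ , y)} eq =
    contradiction (trans (sym (cong (proj₂ ∘ proj₁) eq)) (cong (proj₂ ∘ proj₂) eq)) (inject₁≢suc y)
  primal-injective {d = inj₂ (_ , y)} {inj₁ _} eq =
    contradiction (trans (cong (proj₂ ∘ proj₁) eq) (sym (cong (proj₂ ∘ proj₂) eq))) (inject₁≢suc y)
  primal-injective {d = inj₂ _} {inj₂ _} eq
    with refl , refl ← west-injective (cong (proj₁ ∘ proj₁) eq)
    with refl ← cong (proj₂ ∘ proj₂) eq = refl , refl

  primal-step : ∀ i e → Step (proj₁ (primal i e)) (proj₂ (primal i e))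
  primal-step i (inj₁ (c , y)) = inj₁ (trans (toℕ-east i c) (cong suc (sym (toℕ-west i c))) , refl)
  primal-step i (inj₂ (c , y)) = inj₂ (refl , cong suc (sym (Fin.toℕ-inject₁ y)))

  horizontal-primal : ∀ i c y {u v} → IsHorizontal (column i c) (toℕ y) u v →
                      primal i (inj₁ (c , y)) ≡ (u , v)
  horizontal-primal i c y (x≡ , x′≡ , y≡ , y′≡) =
    cong₂ _,_ (cong₂ _,_ (Fin.toℕ-injective (trans (toℕ-west i c) (sym x≡))) (Fin.toℕ-injective (sym y≡)))
              (cong₂ _,_ (Fin.toℕ-injective (trans (toℕ-east i c) (sym x′≡))) (Fin.toℕ-injective (sym y′≡)))

  vertical-primal : ∀ i c y {u v} → IsVertical (column i (suc c)) (toℕ y) u v →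
                    primal i (inj₂ (c , y)) ≡ (u , v)
  vertical-primal i c y (x≡ , x′≡ , y≡ , y′≡) =
    cong₂ _,_ (cong₂ _,_ (Fin.toℕ-injective (trans (toℕ-west i (suc c)) (sym x≡)))
                         (Fin.toℕ-injective (trans (Fin.toℕ-inject₁ y) (sym y≡))))
              (cong₂ _,_ (Fin.toℕ-injective (trans (toℕ-west i (suc c)) (sym x′≡)))
                         (Fin.toℕ-injective (sym y′≡)))

  Avoids : Fin R → Pred DualEdge 0ℓ → Vertex m n → Vertex m n → Set
  Avoids i X u v = ∀ e → X e → primal i e ≢ (u , v) × primal i e ≢ (v , u)

  -- The parity of the crossings of the path with the vertical ray below a dual
  -- node is constant along the dual edges that the path avoids, but it differs
  -- between the bottom and the top.
  south-north-blocks : ∀ i {X} → Joined X south north → (P : CrossingPath m n) →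
                       ¬ Linked (λ u v → Adj u v × Avoids i X u v) (start P ∷ rest P)
  south-north-blocks i {X} south-north P path =
    contradiction (trans (sym at-south) (trans (Eq.gfold isEquivalence φ φ-link south-north) at-north)) λ ()
    where
    φ : Node → Bool
    φ (c , r) = parity (crosses (column i c) (toℕ r)) (start P) (rest P)

    at-bottom : ∀ c → φ (c , zero) ≡ false
    at-bottom c = parity-false (start P) (rest P)

    left-of : ∀ c → (c <ᵇ toℕ (proj₁ (start P))) ≡ false
    left-of c rewrite left P = refl

    right-end : ∀ c → c < m ∸ 1 → (c <ᵇ toℕ (proj₁ (lastV (start P) (rest P)))) ≡ true
    right-end c c< rewrite right P = <⇒<ᵇ-true c<

    at-top : ∀ c → φ (c , fromℕ n) ≡ true
    at-top c = begin
      φ (c , fromℕ n)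
        -- At level `n` every vertex counts as below, so crossings reduce to changes of side, and
        -- the path ends on the other side.
        ≡⟨ parity-shift {G = λ _ _ → false} (right-of (column i c))
             (λ { (x , y) _ _ → cong₂ _∧_
                    (<⇒<ᵇ-true (subst (toℕ y <_) (sym (Fin.toℕ-fromℕ n)) (Fin.toℕ<n y))) refl })
             (start P) (rest P) path ⟩
      parity (λ _ _ → false) (start P) (rest P) xor _
        ≡⟨ cong₂ _xor_ (parity-false (start P) (rest P))
             (cong₂ _xor_ (left-of (column i c)) (right-end (column i c) (column<last i c))) ⟩
      true ∎
      where open ≡-Reasoning

    at-south : φ south ≡ false
    at-south = at-bottom zero
    at-north : φ north ≡ true
    at-north = at-top zero

    φ-link : ∀ {a b} → Link X a b → φ a ≡ φ b
    φ-link (inj₂ (bottom c d)) = trans (at-bottom c) (sym (at-bottom d))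
    φ-link (inj₂ (top c d))    = trans (at-top c) (sym (at-top d))
    φ-link (inj₁ (inj₁ (c , y) , Xe , refl , refl)) rewrite Fin.toℕ-inject₁ y =
      parity-cong (λ u v (uv , avoids) → crosses-up (column i c) (toℕ y) u v uv
                    (proj₁ (avoids _ Xe) ∘ horizontal-primal i c y)
                    (proj₂ (avoids _ Xe) ∘ horizontal-primal i c y))
        (start P) (rest P) path
    φ-link (inj₁ (inj₂ (c , y) , Xe , refl , refl)) rewrite column-suc i c | Fin.toℕ-inject₁ y = begin
      parity (crosses c₀ (suc (toℕ y))) (start P) (rest P)
        ≡⟨ parity-shift {G = crosses (suc c₀) (suc (toℕ y))} (cornered c₀ (suc (toℕ y)))
             (λ u v (uv , avoids) → crosses-across c₀ (toℕ y) u v uv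
               (proj₁ (avoids _ Xe) ∘ vertical-primal i c y ∘ shift)
               (proj₂ (avoids _ Xe) ∘ vertical-primal i c y ∘ shift))
             (start P) (rest P) path ⟩
      φ₁ xor (cornered c₀ (suc (toℕ y)) (start P) xor cornered c₀ (suc (toℕ y)) (lastV (start P) (rest P)))
        -- The path starts left of both rays and ends right of both, so neither end is cornered.
        ≡⟨ cong (φ₁ xor_) (cong₂ _xor_
             (uncornered (start P) (trans (left-of c₀) (sym (left-of (suc c₀)))))
             (uncornered (lastV (start P) (rest P))
               (trans (right-end c₀ (column<last i (inject₁ c)))
                      (sym (right-end (suc c₀)
                        (subst (_< m ∸ 1) (column-suc i c) (column<last i (suc c)))))))) ⟩
      φ₁ xor false
        ≡⟨ Bool.xor-identityʳ φ₁ ⟩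
      φ₁ ∎
      where
      open ≡-Reasoning
      c₀ = column i (inject₁ c)
      φ₁ = parity (crosses (suc c₀) (suc (toℕ y))) (start P) (rest P)
      uncornered : ∀ u → right-of c₀ u ≡ right-of (suc c₀) u → cornered c₀ (suc (toℕ y)) u ≡ false
      uncornered u eq = begin
        under (suc (toℕ y)) u ∧ (right-of c₀ u xor right-of (suc c₀) u)
          ≡⟨ cong (λ b → under (suc (toℕ y)) u ∧ (b xor right-of (suc c₀) u)) eq ⟩
        under (suc (toℕ y)) u ∧ (right-of (suc c₀) u xor right-of (suc c₀) u)
          ≡⟨ cong (under (suc (toℕ y)) u ∧_) (Bool.xor-same (right-of (suc c₀) u)) ⟩
        under (suc (toℕ y)) u ∧ false
          ≡⟨ Bool.∧-zeroʳ (under (suc (toℕ y)) u) ⟩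
        false ∎
      shift : ∀ {u v} → IsVertical (suc c₀) (toℕ y) u v → IsVertical (column i (suc c)) (toℕ y) u v
      shift = subst (λ l → IsVertical l (toℕ y) _ _) (sym (column-suc i c))

-- Sums over finite vectors.

sum-mono : ∀ {R} {f g : Vector ℕ R} → (∀ i → f i ≤ g i) → sum f ≤ sum g
sum-mono {zero}  f≤g = z≤n
sum-mono {suc R} f≤g = ℕ.+-mono-≤ (f≤g zero) (sum-mono (f≤g ∘ suc))

-- The constants are carried past the other indices. Having one on each side covers both a loss
-- (`a = 0`) and a gain (`b = 0`) at `j`.
sum-mono-at : ∀ {R} {f g : Vector ℕ R} a b j → (∀ i → i ≢ j → f i ≤ g i) →
              a + f j ≤ b + g j → a + sum f ≤ b + sum g
sum-mono-at {suc R} {f} {g} a b zero f≤g at-j = begin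
  a + (f zero + sum (f ∘ suc)) ≡⟨ ℕ.+-assoc a _ _ ⟨
  a + f zero + sum (f ∘ suc)   ≤⟨ ℕ.+-mono-≤ at-j (sum-mono λ i → f≤g (suc i) λ ()) ⟩
  b + g zero + sum (g ∘ suc)   ≡⟨ ℕ.+-assoc b _ _ ⟩
  b + (g zero + sum (g ∘ suc)) ∎
  where open ℕ.≤-Reasoning
sum-mono-at {suc R} {f} {g} a b (suc j) f≤g at-j = begin
  a + (f zero + sum (f ∘ suc)) ≡⟨ x∙yz≈y∙xz a (f zero) _ ⟩
  f zero + (a + sum (f ∘ suc)) ≤⟨ ℕ.+-mono-≤ (f≤g zero λ ())
                                    (sum-mono-at a b j (λ i i≢j → f≤g (suc i) (i≢j ∘ Fin.suc-injective)) at-j) ⟩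
  g zero + (b + sum (g ∘ suc)) ≡⟨ x∙yz≈y∙xz (g zero) b _ ⟩
  b + (g zero + sum (g ∘ suc)) ∎
  where
  open ℕ.≤-Reasoning

sum≤2*sum : ∀ {R} {f g : Vector ℕ R} → (∀ i → f i ≤ 2 * g i) → sum f ≤ 2 * sum g
sum≤2*sum {zero}          f≤2g = z≤n
sum≤2*sum {suc R} {f} {g} f≤2g = begin
  f zero + sum (f ∘ suc)         ≤⟨ ℕ.+-mono-≤ (f≤2g zero) (sum≤2*sum (f≤2g ∘ suc)) ⟩
  2 * g zero + 2 * sum (g ∘ suc) ≡⟨ ℕ.*-distribˡ-+ 2 (g zero) _ ⟨
  2 * (g zero + sum (g ∘ suc))   ∎
  where open ℕ.≤-Reasoning

sum-positive : ∀ {R} (f : Vector ℕ R) → 1 ≤ sum f → ∃[ i ] 1 ≤ f i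
sum-positive {suc R} f 1≤ with f zero in eq
... | suc _ = zero , subst (1 ≤_) (sym eq) (s≤s z≤n)
... | zero  = let i , 1≤fi = sum-positive (f ∘ suc) 1≤ in suc i , 1≤fi

sum-const : ∀ R c → sum {R} (const c) ≡ R * c
sum-const zero    c = refl
sum-const (suc R) c = cong (c +_) (sum-const R c)

some-or-all : ∀ {R} {A : Set} {P : Fin R → Set} → (∀ i → A ⊎ P i) → A ⊎ (∀ i → P i)
some-or-all {zero}  _   = inj₂ λ ()
some-or-all {suc R} dec with dec zero | some-or-all (dec ∘ suc)
... | inj₁ a  | _       = inj₁ a
... | inj₂ _  | inj₁ a  = inj₁ a
... | inj₂ p₀ | inj₂ ps = inj₂ λ { zero → p₀ ; (suc i) → ps i }

-- Block statuses and their weights.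

-- hot₁ and hot₂ record how many edges Maker needs to spoil a block in which
-- Breaker has already moved in the current stage; stock blocks await Breaker's move.
data Status : Set where
  dead stock hot₁ hot₂ : Status

stocked heat : Status → ℕ
stocked stock = 1
stocked _     = 0
heat hot₁ = 1
heat hot₂ = 2
heat _    = 0

hit cool : Status → Status
hit hot₂  = hot₁
hit _     = dead
cool hot₁ = stock
cool hot₂ = stock
cool _    = dead

stocked-hit : ∀ s → stocked s ≤ 1 + stocked (hit s)
stocked-hit dead  = z≤n
stocked-hit stock = s≤s z≤n
stocked-hit hot₁  = z≤n
stocked-hit hot₂  = z≤n

heat-hit : ∀ s → heat s ≤ 1 + heat (hit s)
heat-hit dead  = z≤n
heat-hit stock = z≤n
heat-hit hot₁  = s≤s z≤n
heat-hit hot₂  = s≤s (s≤s z≤n)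

-- No block is hotter than 2, so half of the total heat bounds the stock of the next stage from
-- below.
heat≤2*cool : ∀ s → heat s ≤ 2 * stocked (cool s)
heat≤2*cool dead  = z≤n
heat≤2*cool stock = z≤n
heat≤2*cool hot₁  = s≤s z≤n
heat≤2*cool hot₂  = s≤s (s≤s z≤n)

step-asym : ∀ {m n} {u v : Vertex m n} → Step u v → ¬ Step v u
step-asym (inj₁ (x′≡ , _))    (inj₁ (x≡ , _))    = ℕ.<-asym (ℕ.≤-reflexive (sym x′≡)) (ℕ.≤-reflexive (sym x≡))
step-asym (inj₁ (x′≡ , _))    (inj₂ (refl , _))  = ℕ.1+n≢n (sym x′≡)
step-asym (inj₂ (refl , _))   (inj₁ (x≡ , _))    = ℕ.1+n≢n (sym x≡)
step-asym (inj₂ (_ , y′≡))    (inj₂ (_ , y≡))    = ℕ.<-asym (ℕ.≤-reflexive (sym y′≡)) (ℕ.≤-reflexive (sym y≡))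

-- The invariant over all blocks and its upkeep under the moves of both players.

module Game (k R m : ℕ) (room : R * suc k < m) where
  open Block k
  open Board k R m room

  _≟ᴱ_ : DecidableEquality Edge
  _≟ᴱ_ = Product.≡-dec (Product.≡-dec Fin._≟_ Fin._≟_) (Product.≡-dec Fin._≟_ Fin._≟_)

  IsStep : Pred Edge 0ℓ
  IsStep (u , v) = Step u v

  -- `Claimed` looks for both orientations, but the lists hold only canonical steps, which cannot be
  -- reversed.
  unclaimed : ∀ {S u v} → All IsStep S → Step u v → (u , v) ∉ S → ¬ Claimed S u v
  unclaimed steps uv uv∉S (inj₁ uv∈S) = uv∉S uv∈S
  unclaimed steps uv uv∉S (inj₂ vu∈S) = step-asym uv (All.lookup steps vu∈S)

  On : Fin R → EdgeSet m n → Pred DualEdge 0ℓ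
  On i S e = primal i e ∈ S

  spanning⇒won : ∀ {i B} → Spanning (On i B) → BreakerWon B
  spanning⇒won {i} spans P avoids =
    south-north-blocks i (spans south north) P (Linked.zip (adj P , Linked.map
      (λ {u} {v} uv∉B e e∈B → (λ { refl → uv∉B (inj₁ e∈B) }) , (λ { refl → uv∉B (inj₂ e∈B) })) avoids))

  Holds : ℕ → Status → Pred DualEdge 0ℓ → Pred DualEdge 0ℓ → Set
  Holds l dead  M B = ⊤
  Holds l stock M B = Ready l M B
  Holds l hot₁  M B = Pending l M B
  Holds l hot₂  M B = Balanced l M B

  holds-resp : ∀ {l M B M′ B′} s → M′ ⊆ M → B ⊆ B′ → B′ ⊆ B → Holds l s M B → Holds l s M′ B′
  holds-resp dead  _    _    _    _           = tt
  holds-resp stock M′⊆M B⊆B′ B′⊆B h           = ready-resp M′⊆M B⊆B′ B′⊆B h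
  holds-resp hot₁  M′⊆M B⊆B′ B′⊆B (s , t , P) = s , t , position-resp M′⊆M B⊆B′ B′⊆B P
  holds-resp hot₂  M′⊆M B⊆B′ B′⊆B (s , P)     = s , position-resp M′⊆M B⊆B′ B′⊆B P

  record Invariant (l : ℕ) (st : Vector Status R) (M B : EdgeSet m n) : Set where
    field
      stepsᴹ   : All IsStep M
      stepsᴮ   : All IsStep B
      disjoint : ∀ {e} → e ∈ B → e ∉ M
      holds    : ∀ i → Holds l (st i) (On i M) (On i B)
  open Invariant

  stockpile totalHeat : Vector Status R → ℕ
  stockpile st = sum (stocked ∘ st)
  totalHeat st = sum (heat ∘ st)

  cons⁻ : ∀ {i e x} {S : EdgeSet m n} → primal i e ∈ x ∷ S → primal i e ≡ x ⊎ On i S e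
  cons⁻ (here eq)  = inj₁ eq
  cons⁻ (there e∈) = inj₂ e∈

  set-others : ∀ {l M B M′ B′} {st : Vector Status R} j s →
    (∀ i → i ≢ j → Holds l (st i) (On i M) (On i B) → Holds l (st i) (On i M′) (On i B′)) →
    Holds l s (On j M′) (On j B′) → (∀ i → Holds l (st i) (On i M) (On i B)) →
    ∀ i → Holds l (updateAt st j (const s) i) (On i M′) (On i B′)
  set-others {st = st} j s others at-j hs i with i Fin.≟ j
  ... | yes refl rewrite updateAt-updates j {const s} st    = at-j
  ... | no i≢j   rewrite updateAt-minimal i j {const s} st i≢j = others i i≢j (hs i)

  set-sum : ∀ (w : Status → ℕ) (st : Vector Status R) j s a b →
            a + w (st j) ≤ b + w s → a + sum (w ∘ st) ≤ b + sum (w ∘ updateAt st j (const s))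
  set-sum w st j s a b le = sum-mono-at a b j
    (λ i i≢j → ℕ.≤-reflexive (cong w (sym (updateAt-minimal i j st i≢j))))
    (subst (λ s′ → a + w (st j) ≤ b + w s′) (sym (updateAt-updates j st)) le)

  -- By injectivity of `primal` an edge of Maker lies in at most one block, so at most one status is
  -- hit.
  makerEdge : ∀ {l st M B e} → IsStep e → e ∉ B → Invariant l st M B →
    ∃[ st′ ] Invariant l st′ (e ∷ M) B ×
             stockpile st ≤ 1 + stockpile st′ × totalHeat st ≤ 1 + totalHeat st′
  makerEdge {l} {st} {M} {B} {e} step e∉B inv
    with Fin.any? (λ i → Any.any? (λ d → primal i d ≟ᴱ e) allEdges)
  ... | no missed = st , record
    { stepsᴹ   = step ∷ stepsᴹ inv
    ; stepsᴮ   = stepsᴮ inv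
    ; disjoint = λ { x∈B (here refl) → e∉B x∈B ; x∈B (there x∈M) → disjoint inv x∈B x∈M }
    ; holds    = λ i → holds-resp (st i)
        (λ {d} d∈ → [ (λ d≡e → contradiction (i , Any.map (λ { refl → d≡e }) (∈-allEdges d)) missed)
                   , id ]′ (cons⁻ d∈))
        id id (holds inv i)
    } , ℕ.n≤1+n _ , ℕ.n≤1+n _
  ... | yes (j , found) with Any.satisfied found
  ...   | d , refl = updateAt st j (const (hit (st j))) , record
    { stepsᴹ   = step ∷ stepsᴹ inv
    ; stepsᴮ   = stepsᴮ inv
    ; disjoint = λ { x∈B (here refl) → e∉B x∈B ; x∈B (there x∈M) → disjoint inv x∈B x∈M }
    ; holds    = set-others j (hit (st j))
        (λ i i≢j → holds-resp (st i)
          (λ x∈ → [ (λ x≡e → contradiction (proj₁ (primal-injective x≡e)) i≢j) , id ]′ (cons⁻ x∈)) id id)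
        (struck (st j) (holds inv j)) (holds inv)
    } , set-sum stocked st j _ 0 1 (stocked-hit (st j)) , set-sum heat st j _ 0 1 (heat-hit (st j))
    where
    struck : ∀ s → Holds l s (On j M) (On j B) → Holds l (hit s) (On j (primal j d ∷ M)) (On j B)
    struck dead  _ = tt
    struck stock _ = tt
    struck hot₁  _ = tt
    struck hot₂  h = lose e∉B (λ x∈ → [ inj₂ ∘ proj₂ ∘ primal-injective , inj₁ ]′ (cons⁻ x∈)) h

  makerTurn : ∀ {l st M B} mv → All IsStep mv → All (_∉ B) mv → Invariant l st M B →
    ∃[ st′ ] Invariant l st′ (mv ++ M) B ×
             stockpile st ≤ length mv + stockpile st′ × totalHeat st ≤ length mv + totalHeat st′
  makerTurn {st = st} [] _ _ inv = st , inv , ℕ.≤-refl , ℕ.≤-refl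
  makerTurn (e ∷ mv) (step ∷ steps) (e∉B ∷ mv∉B) inv =
    let st₁ , inv₁ , stock₁ , heat₁ = makerTurn mv steps mv∉B inv
        st₂ , inv₂ , stock₂ , heat₂ = makerEdge step e∉B inv₁
    in st₂ , inv₂ , chain (length mv) stock₁ stock₂ , chain (length mv) heat₁ heat₂
    where
    chain : ∀ {a b c} r → a ≤ r + b → b ≤ 1 + c → a ≤ suc r + c
    chain r a≤ b≤ = ℕ.≤-trans a≤ (ℕ.≤-trans (ℕ.+-monoʳ-≤ r b≤) (ℕ.≤-reflexive (ℕ.+-suc r _)))

  stock-block : ∀ {st} → 1 ≤ stockpile st → ∃[ i ] st i ≡ stock
  stock-block {st} 1≤ with sum-positive (stocked ∘ st) 1≤
  ... | i , 1≤i = i , stocked-positive (st i) 1≤i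
    where
    stocked-positive : ∀ s → 1 ≤ stocked s → s ≡ stock
    stocked-positive stock _ = refl

  -- Each edge is played in a stock block, of heat 0, which becomes `hot₂`; as it then leaves the
  -- stock, the `r` edges fall in distinct blocks.
  breakerTurn : ∀ {l st M B} r → Invariant l st M B → r ≤ stockpile st →
    ∃[ mv ] ∃[ st′ ] length mv ≡ r × Unique mv × All IsStep mv × All (_∉ M) mv × All (_∉ B) mv ×
      Invariant l st′ M (mv ++ B) ×
      stockpile st ≤ r + stockpile st′ × 2 * r + totalHeat st ≤ totalHeat st′
  breakerTurn {st = st} zero inv _ = [] , st , refl , [] , [] , [] , [] , inv , ℕ.≤-refl , ℕ.≤-refl
  breakerTurn {l} {st} {M} {B} (suc r) inv r<
    with mv , st₁ , len , uniq , steps , mv∉M , mv∉B , inv₁ , stock₁ , heat₁ ← breakerTurn r inv (ℕ.<⇒≤ r<)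
    -- The first `r` edges used at most `r` of the more than `r` stock blocks.
    with j , st₁j≡ ← stock-block {st₁}
           (ℕ.+-cancelˡ-≤ r 1 _ (ℕ.≤-trans (ℕ.≤-reflexive (ℕ.+-comm r 1)) (ℕ.≤-trans r< stock₁)))
    with f , f∉M , f∉B , bal ← subst (λ s → Holds l s (On j M) (On j (mv ++ B))) st₁j≡ (holds inv₁ j) =
      primal j f ∷ mv , updateAt st₁ j (const hot₂) , cong suc len ,
      All.tabulate (λ { x∈mv refl → f∉B (∈-++⁺ˡ x∈mv) }) ∷ uniq ,
      primal-step j f ∷ steps , f∉M ∷ mv∉M , (f∉B ∘ ∈-++⁺ʳ mv) ∷ mv∉B ,
      record
        { stepsᴹ   = stepsᴹ inv₁
        ; stepsᴮ   = primal-step j f ∷ stepsᴮ inv₁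
        ; disjoint = λ { (here refl) → f∉M ; (there x∈) → disjoint inv₁ x∈ }
        ; holds    = set-others j hot₂
            (λ i i≢j → holds-resp (st₁ i) id there
              (λ x∈ → [ (λ x≡f → contradiction (proj₁ (primal-injective x≡f)) i≢j) , id ]′ (cons⁻ x∈)))
            (holds-resp hot₂ id
              [ there , (λ { refl → here refl }) ]′
              (λ x∈ → [ inj₂ ∘ sym ∘ proj₂ ∘ primal-injective , inj₁ ]′ (cons⁻ x∈)) bal)
            (holds inv₁)
        } ,
      (begin
        stockpile st                              ≤⟨ stock₁ ⟩
        r + stockpile st₁                         ≤⟨ ℕ.+-monoʳ-≤ r (set-sum stocked st₁ j hot₂ 0 1
                                                       (subst (λ s → stocked s ≤ 1) (sym st₁j≡) ℕ.≤-refl)) ⟩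
        r + suc (stockpile st₂)                   ≡⟨ ℕ.+-suc r _ ⟩
        suc r + stockpile st₂                     ∎) ,
      (begin
        2 * suc r + totalHeat st                  ≡⟨ cong (_+ totalHeat st) (ℕ.*-suc 2 r) ⟩
        2 + (2 * r + totalHeat st)                ≤⟨ ℕ.+-monoʳ-≤ 2 heat₁ ⟩
        2 + totalHeat st₁                         ≤⟨ set-sum heat st₁ j hot₂ 2 0
                                                       (subst (λ s → 2 + heat s ≤ 2) (sym st₁j≡) ℕ.≤-refl) ⟩
        totalHeat st₂                             ∎)
      where
      open ℕ.≤-Reasoning
      st₂ = updateAt st₁ j (const hot₂)

  -- In a ready block Breaker's edges with `f` and `T₂` connect south to north and avoid Maker's
  -- edges, so every crossing path uses an edge that Maker lacks.
  ready⇒¬makerWon : ∀ {l i M B} → All IsStep M → (∀ {e} → e ∈ B → e ∉ M) →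
               Ready l (On i M) (On i B) → ¬ MakerWon M
  ready⇒¬makerWon {i = i} {M} {B} steps B∉M (f , f∉M , _ , _ , pos) (P , claimed) =
    south-north-blocks i (spanning₂ south north) P
      (Linked.zip (adj P , Linked.map avoid claimed))
    where
    open Position pos
    free : ∀ {e} → ((On i B ∪ ｛ f ｝) ∪ (_∈ T₂)) e → primal i e ∉ M
    free (inj₁ (inj₁ e∈B))  = B∉M e∈B
    free (inj₁ (inj₂ refl)) = f∉M
    free (inj₂ e∈T₂)        = proj₁ (free₂ e∈T₂)
    avoid : ∀ {u v} → Claimed M u v → Avoids i ((On i B ∪ ｛ f ｝) ∪ (_∈ T₂)) u v
    avoid claimed e Xe =
      (λ { refl → unclaimed steps (primal-step i e) (free Xe) claimed }) ,
      (λ { refl → unclaimed steps (primal-step i e) (free Xe) (Sum.swap claimed) })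

  -- Each hot block either is already spanned by Breaker or yields Breaker's next edge there, and
  -- its size bound drops by one.
  cooled : ∀ {l st M B} → Invariant (suc l) st M B → BreakerWon B ⊎ Invariant l (cool ∘ st) M B
  cooled {l} {st} {M} {B} inv = Sum.map₂
    (λ hs → record { stepsᴹ = stepsᴹ inv ; stepsᴮ = stepsᴮ inv ; disjoint = disjoint inv ; holds = hs })
    (some-or-all λ i → restock i (st i) (holds inv i))
    where
    restock : ∀ i s → Holds (suc l) s (On i M) (On i B) → BreakerWon B ⊎ Holds l (cool s) (On i M) (On i B)
    restock i dead  _       = inj₂ tt
    restock i stock _       = inj₂ tt
    restock i hot₁  h       = Sum.map₁ spanning⇒won (advance h)
    restock i hot₂  (s , P) = Sum.map₁ spanning⇒won (advance (s , s , P))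

  hot⇒won : ∀ {st M B} → Invariant 0 st M B → 1 ≤ totalHeat st → BreakerWon B
  hot⇒won {st} inv 1≤ with sum-positive (heat ∘ st) 1≤
  ... | i , 1≤heat with st i | holds inv i
  ...   | hot₁ | h     = spanning⇒won (finish h)
  ...   | hot₂ | s , P = spanning⇒won (finish (s , s , P))

-- The stages of the strategy and the final count of blocks.

needed : ℕ → ℕ → ℕ
needed q zero    = 1
-- A stage of `2 * needed q l` turns, each using up to `3 * q` stock blocks, ends with heat at least
-- `2 * needed q l`, hence with at least `needed q l` hot blocks.
needed q (suc l) = 2 * needed q l * (3 * q)

module Strategy (k R m : ℕ) (room : R * suc k < m) (p q : ℕ) (p<2q : p + 1 ≤ 2 * q) where
  open Block k
  open Board k R m room
  open Game k R m room

  length≤p : ∀ {mv M B : EdgeSet m n} → ValidMove p M B mv → length mv ≤ p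
  length≤p (_ , _ , inj₁ len)       = ℕ.≤-reflexive len
  length≤p (_ , _ , inj₂ (len , _)) = ℕ.<⇒≤ len

  maker : ∀ {l st M B mv} → ValidMove p M B mv → Invariant l st M B →
    ∃[ st′ ] Invariant l st′ (mv ++ M) B ×
             stockpile st ≤ p + stockpile st′ × totalHeat st ≤ p + totalHeat st′
  maker {M = M} {B} {mv} valid inv =
    let st′ , inv′ , stock≤ , heat≤ = makerTurn mv
          (All.map proj₁ (proj₁ (proj₂ valid)))
          (All.map (λ (_ , _ , e∉B) e∈B → e∉B (inj₁ e∈B)) (proj₁ (proj₂ valid))) inv
    in st′ , inv′ , ℕ.≤-trans stock≤ (ℕ.+-monoˡ-≤ _ (length≤p {mv} {M} {B} valid)) ,
                    ℕ.≤-trans heat≤ (ℕ.+-monoˡ-≤ _ (length≤p {mv} {M} {B} valid))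

  1≤q : 1 ≤ q
  1≤q = ℕ.*-cancelˡ-< 2 0 q (ℕ.≤-trans (ℕ.m≤n+m 1 p) p<2q)

  q≤3q : q ≤ 3 * q
  q≤3q = ℕ.m≤m+n q _

  -- Each full turn raises the heat by at least 2q - p ≥ 1 and uses at most 3q
  -- blocks of the stock, so that t more turns bring the heat to 2 * needed q l.
  -- The hot blocks then form the stock of the next stage.
  play : ∀ l t {st M B} → Invariant l st M B → t * (3 * q) ≤ stockpile st →
         2 * needed q l ≤ totalHeat st + t → BreakerWinsB m n p q M B
  play zero zero {st} inv _ hot =
    wonB (hot⇒won inv (ℕ.≤-trans (s≤s z≤n) (ℕ.≤-trans hot (ℕ.≤-reflexive (ℕ.+-identityʳ _)))))
  play (suc l) zero {st} inv _ hot with cooled inv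
  ... | inj₁ won  = wonB won
  -- Even from no heat, a gain of one per turn reaches the target in `2 * needed q l` turns; the
  -- stock suffices by the recursion of `needed`.
  ... | inj₂ inv′ = play l (2 * needed q l) inv′
    (ℕ.*-cancelˡ-≤ 2 (ℕ.≤-trans hot (ℕ.≤-trans (ℕ.≤-reflexive (ℕ.+-identityʳ _))
      (sum≤2*sum (heat≤2*cool ∘ st)))))
    (ℕ.m≤n+m (2 * needed q l) (totalHeat (cool ∘ st)))
  play l (suc t) {st} {M} {B} inv enough hot
    with mv , st₁ , len , uniq , steps , mv∉M , mv∉B , inv₁ , stock₁ , heat₁
           ← breakerTurn q inv (ℕ.≤-trans q≤3q (ℕ.m+n≤o⇒m≤o (3 * q) enough))
    with j , stj≡ ← stock-block {st} (ℕ.≤-trans 1≤q (ℕ.≤-trans q≤3q (ℕ.m+n≤o⇒m≤o (3 * q) enough))) =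
    -- The stock block `j` certifies that Maker has not won yet.
    moveB (ready⇒¬makerWon (stepsᴹ inv) (disjoint inv)
            (subst (λ s → Holds l s (On j M) (On j B)) stj≡ (holds inv j)))
      (mv ,
       (uniq ,
        All.tabulate (λ {e} e∈ → All.lookup steps e∈ ,
          unclaimed (stepsᴹ inv) (All.lookup steps e∈) (All.lookup mv∉M e∈) ,
          unclaimed (stepsᴮ inv) (All.lookup steps e∈) (All.lookup mv∉B e∈)) ,
        inj₁ len) ,
       moveM λ mv′ valid → let st₂ , inv₂ , stock₂ , heat₂ = maker valid inv₁ in
         play l t inv₂ (stock-left stock₁ stock₂) (heat-gained heat₁ heat₂))
    where
    open Invariant
    open ℕ.≤-Reasoning
    stock-left : ∀ {a b} → stockpile st ≤ q + a → a ≤ p + b → t * (3 * q) ≤ b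
    stock-left {a} {b} s≤ a≤ = ℕ.+-cancelˡ-≤ (3 * q) _ _ (begin
      3 * q + t * (3 * q) ≤⟨ enough ⟩
      stockpile st        ≤⟨ s≤ ⟩
      q + a               ≤⟨ ℕ.+-monoʳ-≤ q a≤ ⟩
      q + (p + b)         ≤⟨ ℕ.+-monoʳ-≤ q (ℕ.+-monoˡ-≤ b (ℕ.m+n≤o⇒m≤o p p<2q)) ⟩
      q + (2 * q + b)     ≡⟨ ℕ.+-assoc q (2 * q) b ⟨
      3 * q + b           ∎)
    heat-gained : ∀ {a b} → 2 * q + totalHeat st ≤ a → a ≤ p + b → 2 * needed q l ≤ b + t
    -- Cancelling `p + 1`, not just `p`, uses that `p` is strictly below `2 * q`: the extra unit
    -- pays for the turn just spent.
    heat-gained {a} {b} h≤ a≤ = ℕ.+-cancelˡ-≤ (p + 1) _ _ (begin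
      p + 1 + 2 * needed q l        ≤⟨ ℕ.+-mono-≤ p<2q hot ⟩
      2 * q + (totalHeat st + suc t) ≡⟨ ℕ.+-assoc (2 * q) _ _ ⟨
      2 * q + totalHeat st + suc t  ≤⟨ ℕ.+-monoˡ-≤ (suc t) (ℕ.≤-trans h≤ a≤) ⟩
      p + b + suc t                 ≡⟨ regroup p b t ⟩
      p + 1 + (b + t)               ∎)
      where
      regroup : ∀ p b t → p + b + suc t ≡ p + 1 + (b + t)
      regroup = solve-∀

  -- `fresh` supplies a pending position, with `south` and `north` as centres, hence `hot₁` and heat
  -- 1 for each block.
  opening : Invariant K (const hot₁) [] []
  opening = record
    { stepsᴹ = [] ; stepsᴮ = [] ; disjoint = λ () ; holds = λ _ → fresh (λ _ ()) (λ _ ()) }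

  breakerWins : p + 2 * needed q K ≤ R → BreakerWinsGame m n p q
  breakerWins enough = moveM λ mv valid →
    let st , inv , _ , heat≤ = maker valid opening
    -- Maker's opening turn removes at most `p` of the total heat `R`; the rest meets the target at
    -- once, so the opening stage has no turns.
    in play K 0 inv z≤n (ℕ.≤-trans
         (ℕ.+-cancelˡ-≤ p _ _ (ℕ.≤-trans enough
           (subst (_≤ p + totalHeat st) (trans (sum-const R 1) (ℕ.*-identityʳ R)) heat≤)))
         (ℕ.m≤m+n _ 0))

theorem1p2 : (n q : ℕ) → Σ ℕ (λ m₀ → (p m : ℕ) → p + 1 ≤ 2 * q → m₀ ≤ m
    → BreakerWinsGame m n p q)
-- Without rows there is no vertex, hence no path to block.
theorem1p2 zero    q = 0 , λ p m _ _ → wonM λ P → contradiction (proj₂ (start P)) λ ()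
-- The `R * suc k` columns of horizontal edges need one more column of vertices.
theorem1p2 (suc k) q = suc (R * suc k) , λ p m p<2q room →
  Strategy.breakerWins k R m room p q p<2q (ℕ.+-monoˡ-≤ _ (ℕ.m+n≤o⇒m≤o p p<2q))
  where
  -- The bound `2 * q` stands in for `p`, on which `R` may not depend.
  R = 2 * q + 2 * needed q (Block.K k)
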